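{- Let $1\le m\le n$ be integers. If $n\ge 7$, then the complete bipartite graph $K_{m,n}$ is not a unit rectangle visibility graph.
   Context: A finite simple graph $G$ is a unit rectangle visibility graph (URVG) if its vertices $v$ can be represented by closed unit squares $S_v$ in the plane with sides parallel to the coordinate axes and with pairwise disjoint interiors (squares may touch along their boundaries), in such a way that two distinct vertices $v,w$ are adjacent if and only if there is an unobstructed non-degenerate (positive width) horizontal or vertical band of visibility joining $S_v$ and $S_w$. Here a horizontal band of visibility joining $S_v$ and $S_w$ is given by an open interval $I$ of positive length such that for every $y_0\in I$ the line $y=y_0$ meets the interiors of both $S_v$ and $S_w$, and the part of this line between $S_v$ and $S_w$ (possibly a single point if the squares touch) meets the interior of no other square of the representation; vertical bands are defined analogously with the roles of $x$ and $y$ exchanged. -}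

module Defs where

open import Level using (0ℓ)
open import Data.Empty using (⊥)
open import Data.Fin using (Fin)
open import Data.Fin.Properties using (+↔⊎)
open import Data.Nat as ℕ using (ℕ)
open import Data.Product using (∃; Σ-syntax; ∃-syntax; _×_; _,_; swap)
open import Data.Rational as ℚ using (ℚ; 1ℚ)
open import Data.Rational.Properties using (+-0-group; +-monoˡ-<)
open import Data.Sum using (_⊎_; inj₁; inj₂)
open import Data.Unit using (⊤; tt)
open import Algebra.Properties.Group +-0-group
  using () renaming (//-rightDividesˡ to -+-cancel; //-rightDividesʳ to +--cancel)
open import Function using (_∘_; _⇔_; _↔_; mk⇔; Equivalence)
open import Relation.Binary.PropositionalEquality using (_≡_; _≢_; sym; subst)
open import Relation.Nullary using (¬_)
open import Relation.Unary using (Pred)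

-- Two-sided Dedekind cuts.  Set-valued cuts are not extensional for _≡_, so
-- real numbers are only ever compared through _<_ and _≤_ below.

record ℝ : Set₁ where
  field
    Lower Upper : Pred ℚ 0ℓ
    lower-inhabited : ∃ Lower
    upper-inhabited : ∃ Upper
    lower-rounded   : ∀ q → Lower q ⇔ (∃[ r ] q ℚ.< r × Lower r)
    upper-rounded   : ∀ r → Upper r ⇔ (∃[ q ] q ℚ.< r × Upper q)
    disjoint        : ∀ q → ¬ (Lower q × Upper q)
    located         : ∀ q r → q ℚ.< r → Lower q ⊎ Upper r

open ℝ

infix 4 _<_ _≤_
infixl 6 _+_

_<_ : ℝ → ℝ → Set
x < y = ∃[ q ] Upper x q × Lower y q

_≤_ : ℝ → ℝ → Set
x ≤ y = ¬ (y < x)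

-- Only the translation of a real by a rational is needed, not general addition.

_+_ : ℝ → ℚ → ℝ
x + c = record
  { Lower = λ q → Lower x (q ℚ.- c)
  ; Upper = λ q → Upper x (q ℚ.- c)
  ; lower-inhabited = let q , l = lower-inhabited x in q ℚ.+ c , shift (Lower x) l
  ; upper-inhabited = let q , u = upper-inhabited x in q ℚ.+ c , shift (Upper x) u
  ; lower-rounded = λ q → mk⇔
      (λ l → let r , q-c<r , l′ = to (lower-rounded x (q ℚ.- c)) l
             in r ℚ.+ c
              , subst (ℚ._< r ℚ.+ c) (-+-cancel c q) (+-monoˡ-< c q-c<r)
              , shift (Lower x) l′)
      (λ (r , q<r , l) → from (lower-rounded x (q ℚ.- c))
         (r ℚ.- c , +-monoˡ-< (ℚ.- c) q<r , l))
  ; upper-rounded = λ r → mk⇔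
      (λ u → let q , q<r-c , u′ = to (upper-rounded x (r ℚ.- c)) u
             in q ℚ.+ c
              , subst (q ℚ.+ c ℚ.<_) (-+-cancel c r) (+-monoˡ-< c q<r-c)
              , shift (Upper x) u′)
      (λ (q , q<r , u) → from (upper-rounded x (r ℚ.- c))
         (q ℚ.- c , +-monoˡ-< (ℚ.- c) q<r , u))
  ; disjoint = λ q → disjoint x (q ℚ.- c)
  ; located = λ q r q<r → located x (q ℚ.- c) (r ℚ.- c) (+-monoˡ-< (ℚ.- c) q<r)
  }
  where
  open Equivalence using (to; from)

  shift : (P : Pred ℚ 0ℓ) → ∀ {q} → P q → P ((q ℚ.+ c) ℚ.- c)
  shift P {q} = subst P (sym (+--cancel c q))

record FiniteSimpleGraph : Set₁ where
  field
    Vertex : Set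
    order  : ℕ
    finite : Fin order ↔ Vertex
    Adj    : Vertex → Vertex → Set
    symmetric   : ∀ {v w} → Adj v w → Adj w v
    irreflexive : ∀ {v} → ¬ Adj v v

Point : Set₁
Point = ℝ × ℝ

-- A closed axis-parallel unit square is given by its lower left corner.

Interior : Point → Pred Point 0ℓ
Interior (a , b) (x , y) = (a < x × x < a + 1ℚ) × (b < y × y < b + 1ℚ)

module _ {V : Set} (corner : V → Point) where

  InteriorsDisjoint : Set₁
  InteriorsDisjoint =
    ∀ v w → v ≢ w → ¬ (∃[ p ] Interior (corner v) p × Interior (corner w) p)

  MeetsInterior : ℝ → V → Set₁
  MeetsInterior y v = ∃[ x ] Interior (corner v) (x , y)

  -- The abscissae of the part of a horizontal line (meeting both squares)
  -- that lies between them; either of the two may be the left one.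

  Between : V → V → ℝ → Set
  Between v w x = let (a , _) = corner v ; (c , _) = corner w in
    (a + 1ℚ ≤ x × x ≤ c) ⊎ (c + 1ℚ ≤ x × x ≤ a)

  HorizontalBand : V → V → Set₁
  HorizontalBand v w =
    Σ[ s ∈ ℝ ] Σ[ t ∈ ℝ ] s < t ×
      (∀ y → s < y → y < t →
        MeetsInterior y v × MeetsInterior y w ×
        (∀ x → Between v w x →
          ∀ u → u ≢ v → u ≢ w → ¬ Interior (corner u) (x , y)))

VerticalBand : {V : Set} → (V → Point) → V → V → Set₁
VerticalBand corner = HorizontalBand (swap ∘ corner)

IsURVG : FiniteSimpleGraph → Set₁
IsURVG G =
  Σ[ corner ∈ (Vertex → Point) ]
    InteriorsDisjoint corner ×
    (∀ v w → v ≢ w →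
      Adj v w ⇔ (HorizontalBand corner v w ⊎ VerticalBand corner v w))
  where open FiniteSimpleGraph G

K : ℕ → ℕ → FiniteSimpleGraph
K m n = record
  { Vertex = Fin m ⊎ Fin n
  ; order = m ℕ.+ n
  ; finite = +↔⊎
  ; Adj = Adj
  ; symmetric = λ {v} {w} → symmetric v w
  ; irreflexive = λ {v} → irreflexive v
  }
  where
  Adj : Fin m ⊎ Fin n → Fin m ⊎ Fin n → Set
  Adj (inj₁ _) (inj₁ _) = ⊥
  Adj (inj₁ _) (inj₂ _) = ⊤
  Adj (inj₂ _) (inj₁ _) = ⊤
  Adj (inj₂ _) (inj₂ _) = ⊥

  symmetric : ∀ v w → Adj v w → Adj w v
  symmetric (inj₁ _) (inj₂ _) _ = tt
  symmetric (inj₂ _) (inj₁ _) _ = tt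

  irreflexive : ∀ v → ¬ Adj v v
  irreflexive (inj₁ _) ()
  irreflexive (inj₂ _) ()

module Submission where

open import Data.Nat using (ℕ; _≤_)
open import Relation.Nullary using (¬_)
open import Defs using (IsURVG; K)

open import Defs
  using (ℝ; Point; Interior; InteriorsDisjoint; HorizontalBand; FiniteSimpleGraph)
  renaming (_<_ to _<ᴿ_; _≤_ to _≤ᴿ_; _+_ to _+ᴿ_)
open import Algebra.Properties.Group using () renaming (//-rightDividesʳ to +--cancel)
open import Data.Bool using (Bool; true; false; not)
open import Data.Bool.Properties using (_≟_; not-¬; not-involutive)
open import Data.Fin using (Fin; zero)
open import Data.Integer as ℤ using (+_; -[1+_]; ∣_∣)
import Data.Integer.Properties as ℤ
open import Data.Integer.Tactic.RingSolver using (solve-∀)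
open import Data.List using (List; []; _∷_; length; map; _++_; allFin; cartesianProduct)
open import Data.List.Membership.Propositional using (_∈_; lose)
open import Data.List.Membership.Propositional.Properties
  using (∈-allFin; ∈-map⁺; ∈-++⁺ˡ; ∈-++⁺ʳ; ∈-cartesianProduct⁺)
open import Data.List.Properties using (length-map; length-tabulate)
open import Data.List.Relation.Binary.Sublist.Propositional using (_⊆_; []; _∷_; _∷ʳ_)
open import Data.List.Relation.Binary.Sublist.Propositional.Properties using (All-resp-⊆)
open import Data.List.Relation.Unary.All as All using (All; []; _∷_)
import Data.List.Relation.Unary.All.Properties as All
open import Data.List.Relation.Unary.AllPairs using ([]; _∷_)
open import Data.List.Relation.Unary.Any using (any?; satisfied; here; there)
open import Data.List.Relation.Unary.Unique.Propositional using (Unique)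
import Data.List.Relation.Unary.Unique.Propositional.Properties as Unique
open import Data.Nat as ℕ using (zero; suc; z≤n; s≤s)
import Data.Nat.Properties as ℕ
open import Data.Product using (∃; ∃-syntax; _×_; _,_; proj₁; proj₂; swap)
open import Data.Rational as ℚ using (ℚ; mkℚ; 0ℚ; ½; 1ℚ; toℚᵘ)
import Data.Rational.Properties as ℚ
open import Data.Rational.Unnormalised as ℚᵘ using (mkℚᵘ)
import Data.Rational.Unnormalised.Properties as ℚᵘ
open import Data.Sum as Sum using (_⊎_; inj₁; inj₂; [_,_]′)
open import Data.Sum.Properties using (inj₂-injective)
open import Data.Unit using (tt)
open import Function using (_∘_; id; flip; const; mk⇔; Equivalence)
open import Relation.Binary.Definitions using (tri<; tri≈; tri>)
open import Relation.Binary.PropositionalEquality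
  using (_≡_; _≢_; refl; sym; trans; cong; subst; ≢-sym)
open import Relation.Nullary using (Dec; yes; no; contradiction; ¬?; _×-dec_)
open import Relation.Nullary.Decidable using (¬¬-excluded-middle; decidable-stable)
open import Relation.Unary using (Decidable)

open ℝ

-- Let P and Q be the two sides, Q the one with at least seven vertices.  The
-- squares met by a generic horizontal or vertical line alternate between P and
-- Q, and no four squares of sides Q, Q, P, P (or P, P, Q, Q) occur in this order
-- from left to right when the middle two share a row: the outer pair and the
-- pairs at distance two would all have to see each other, forcing contradictory
-- orders on the heights of the middle two.
--
-- If v, p ∈ P share a row, with v to the left of p and not higher, then Q has at
-- most 6 vertices: at most one sees v vertically, at most one sees p vertically,
-- and every other one lies either left of p in the topmost row of v or right of
-- v in the lowest row of p, each of which holds at most two.  Otherwise fix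
-- v ∈ P, alone in its rows and columns among P.  Above and below the
-- level of v, on its left and right, there is at most one neighbour each seen
-- horizontally, and not all four occur; so at most 3 are seen horizontally and,
-- by transposition, at most 3 vertically.
--
-- The claim being negative, the finitely many comparisons between ends of sides
-- of squares may be assumed decidable.

-- Real numbers

-- Multiples of ½, built by recursion so that each step of `step-out` peels off one summand.
halves : ℕ → ℚ
halves zero = 0ℚ
halves (suc n) = ½ ℚ.+ halves n

halves-≃ : ∀ n → toℚᵘ (halves n) ℚᵘ.≃ mkℚᵘ (+ n) 1
halves-≃ zero = ℚᵘ.*≡* refl
halves-≃ (suc n) = ℚᵘ.≃-trans (ℚ.toℚᵘ-homo-+ ½ (halves n))
  (ℚᵘ.≃-trans (ℚᵘ.+-congʳ (toℚᵘ ½) (halves-≃ n)) (ℚᵘ.*≡* eq))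
  where
  ring : ∀ x → (+ 1 ℤ.* + 2 ℤ.+ x ℤ.* + 2) ℤ.* + 2 ≡ (+ 1 ℤ.+ x) ℤ.* (+ 4)
  ring = solve-∀
  eq : (+ 1 ℤ.* + 2 ℤ.+ + n ℤ.* + 2) ℤ.* + 2 ≡ + suc n ℤ.* (+ 4)
  eq = ring (+ n)

-- The absolute value of the numerator bounds `p`; it is doubled because `halves` counts in steps of
-- ½.
archimedean : ∀ p → ∃[ n ] p ℚ.≤ halves n
archimedean p@(mkℚ k d-1 _) = ∣ k ∣ ℕ.* 2 , ℚ.toℚᵘ-cancel-≤
  (ℚᵘ.≤-trans (ℚᵘ.*≤* (bound k)) (ℚᵘ.≤-reflexive (ℚᵘ.≃-sym (halves-≃ (∣ k ∣ ℕ.* 2)))))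
  where
  bound : ∀ k → k ℤ.* + 2 ℤ.≤ + (∣ k ∣ ℕ.* 2) ℤ.* + suc d-1
  bound (+ n) rewrite sym (ℤ.pos-* n 2) | sym (ℤ.pos-* (n ℕ.* 2) (suc d-1)) =
    ℤ.+≤+ (ℕ.m≤m*n (n ℕ.* 2) (suc d-1))
  bound -[1+ n ] = ℤ.-≤+

x+y-x≡y : ∀ x y → x ℚ.+ (y ℚ.- x) ≡ y
x+y-x≡y x y = trans (ℚ.+-comm x (y ℚ.- x)) (trans (ℚ.+-assoc y (ℚ.- x) x)
  (trans (cong (y ℚ.+_) (ℚ.+-inverseˡ x)) (ℚ.+-identityʳ y)))

Upper-upward : ∀ x {q r} → q ℚ.< r → Upper x q → Upper x r
Upper-upward x {q} {r} q<r u = Equivalence.from (upper-rounded x r) (q , q<r , u)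

Lower<Upper : ∀ x {q r} → Lower x q → Upper x r → q ℚ.< r
Lower<Upper x {q} {r} l u with ℚ.<-cmp q r
... | tri< q<r _ _ = q<r
... | tri≈ _ refl _ = contradiction (l , u) (disjoint x q)
... | tri> _ _ r<q = contradiction (l , Upper-upward x r<q u) (disjoint x q)

<ᴿ-trans : ∀ {x y z} → x <ᴿ y → y <ᴿ z → x <ᴿ z
<ᴿ-trans {x} {y} (q , ux , ly) (r , uy , lz) = r , Upper-upward x (Lower<Upper y ly uy) ux , lz

<ᴿ-irrefl : ∀ {x} → ¬ (x <ᴿ x)
<ᴿ-irrefl {x} (q , u , l) = disjoint x q (l , u)

-- Constructive stand-in for trichotomy: roundedness opens a rational interval between `x` and `z`,
-- and `y` is located with respect to it.
<ᴿ-cotrans : ∀ {x z} → x <ᴿ z → ∀ y → x <ᴿ y ⊎ y <ᴿ z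
<ᴿ-cotrans {x} {z} (q , ux , lz) y
  with r , q<r , lz′ ← Equivalence.to (lower-rounded z q) lz
  with located y q r q<r
... | inj₁ ly = inj₁ (q , ux , ly)
... | inj₂ uy = inj₂ (r , uy , lz′)

<⇒≤ᴿ : ∀ {x y} → x <ᴿ y → x ≤ᴿ y
<⇒≤ᴿ {x} {y} x<y y<x = <ᴿ-irrefl {x} (<ᴿ-trans {x} {y} {x} x<y y<x)

<-≤-transᴿ : ∀ {x y z} → x <ᴿ y → y ≤ᴿ z → x <ᴿ z
<-≤-transᴿ {x} {y} {z} x<y y≤z with <ᴿ-cotrans {x} {y} x<y z
... | inj₁ x<z = x<z
... | inj₂ z<y = contradiction z<y y≤z

≤-<-transᴿ : ∀ {x y z} → x ≤ᴿ y → y <ᴿ z → x <ᴿ z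
≤-<-transᴿ {x} {y} {z} x≤y y<z with <ᴿ-cotrans {y} {z} y<z x
... | inj₁ y<x = contradiction y<x x≤y
... | inj₂ x<z = x<z

≤ᴿ-trans : ∀ {x y z} → x ≤ᴿ y → y ≤ᴿ z → x ≤ᴿ z
≤ᴿ-trans {x} {y} {z} x≤y y≤z z<x = y≤z (<-≤-transᴿ {z} {x} {y} z<x x≤y)

fromℚ : ℚ → ℝ
fromℚ q = record
  { Lower = ℚ._< q
  ; Upper = q ℚ.<_
  ; lower-inhabited = q ℚ.- 1ℚ ,
      subst (q ℚ.- 1ℚ ℚ.<_) (ℚ.+-identityʳ q) (ℚ.+-monoʳ-< q (ℚ.negative⁻¹ (ℚ.- 1ℚ)))
  ; upper-inhabited = q ℚ.+ 1ℚ ,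
      subst (ℚ._< q ℚ.+ 1ℚ) (ℚ.+-identityʳ q) (ℚ.+-monoʳ-< q (ℚ.positive⁻¹ 1ℚ))
  ; lower-rounded = λ r → mk⇔ ℚ.<-dense (λ (s , r<s , s<q) → ℚ.<-trans r<s s<q)
  ; upper-rounded = λ r → mk⇔ (λ q<r → let s , q<s , s<r = ℚ.<-dense q<r in s , s<r , q<s)
      (λ (s , s<r , q<s) → ℚ.<-trans q<s s<r)
  ; disjoint = λ r (r<q , q<r) → ℚ.<-asym r<q q<r
  ; located = loc
  }
  where
  loc : ∀ r s → r ℚ.< s → r ℚ.< q ⊎ q ℚ.< s
  loc r s r<s with r ℚ.<? q
  ... | yes r<q = inj₁ r<q
  ... | no r≮q = inj₂ (ℚ.≤-<-trans (ℚ.≮⇒≥ r≮q) r<s)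

<ᴿ-dense : ∀ {x z} → x <ᴿ z → ∃[ y ] (x <ᴿ y × y <ᴿ z)
<ᴿ-dense {x} {z} (q , ux , lz) = fromℚ q , below , Equivalence.to (lower-rounded z q) lz
  where
  below : x <ᴿ fromℚ q
  below = let r , r<q , ux′ = Equivalence.to (upper-rounded x q) ux in r , ux′ , r<q

-- Walking up from a lower bound in steps of ½ must leave the lower cut.
step-out : ∀ x n q → Lower x q → Upper x (q ℚ.+ halves n) →
           ∃[ r ] (Lower x r × Upper x (r ℚ.+ 1ℚ))
step-out x zero q l u =
  contradiction (l , subst (Upper x) (ℚ.+-identityʳ q) u) (disjoint x q)
step-out x (suc n) q l u
  with located x (q ℚ.+ ½) (q ℚ.+ 1ℚ) (ℚ.+-monoʳ-< q (ℚ.*<* (ℤ.+<+ (ℕ.s≤s (ℕ.s≤s ℕ.z≤n)))))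
... | inj₁ l′ = step-out x n (q ℚ.+ ½) l′ (subst (Upper x) (sym (ℚ.+-assoc q ½ (halves n))) u)
... | inj₂ u′ = q , l , u′

-- The separating rational is `r + 1`, where `r` lies below `x` and `r + 1` above it; `step-out`
-- finds such an `r`.
x<x+1 : ∀ x → x <ᴿ x +ᴿ 1ℚ
x<x+1 x = let r , l , u = step-out x (suc n) _ (proj₂ (lower-inhabited x)) beyond
          in r ℚ.+ 1ℚ , u , subst (Lower x) (sym (+--cancel ℚ.+-0-group 1ℚ r)) l
  where
  q r : ℚ
  q = proj₁ (lower-inhabited x)
  r = proj₁ (upper-inhabited x)
  n : ℕ
  n = proj₁ (archimedean (r ℚ.- q))
  -- The extra ½ makes the bound of `archimedean` strict.
  r-q<halves : r ℚ.- q ℚ.< halves (suc n)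
  r-q<halves = ℚ.≤-<-trans (proj₂ (archimedean (r ℚ.- q)))
    (subst (ℚ._< halves (suc n)) (ℚ.+-identityˡ (halves n)) (ℚ.+-monoˡ-< (halves n) (ℚ.positive⁻¹ ½)))
  beyond : Upper x (q ℚ.+ halves (suc n))
  beyond = Upper-upward x
    (subst (ℚ._< q ℚ.+ halves (suc n)) (x+y-x≡y q r) (ℚ.+-monoʳ-< q r-q<halves))
    (proj₂ (upper-inhabited x))

+1-mono-< : ∀ {x y} → x <ᴿ y → x +ᴿ 1ℚ <ᴿ y +ᴿ 1ℚ
+1-mono-< {x} {y} (q , u , l) = q ℚ.+ 1ℚ ,
  subst (Upper x) (sym (+--cancel ℚ.+-0-group 1ℚ q)) u , subst (Lower y) (sym (+--cancel ℚ.+-0-group 1ℚ q)) l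

+1-cancel-< : ∀ {x y} → x +ᴿ 1ℚ <ᴿ y +ᴿ 1ℚ → x <ᴿ y
+1-cancel-< (q , u , l) = q ℚ.- 1ℚ , u , l

-- Counting

module _ {A : Set} where

  -- Cardinality is measured by duplicate-free lists, so `C` may be any predicate, decidable or not.
  AtMost : ℕ → (A → Set) → Set
  AtMost k C = ∀ {xs} → Unique xs → All C xs → length xs ℕ.≤ k

  atMost-0 : ∀ {C} → (∀ {x} → ¬ C x) → AtMost 0 C
  atMost-0 ¬C {[]} _ _ = z≤n
  atMost-0 ¬C {_ ∷ _} _ (c ∷ _) = contradiction c ¬C

  module _ {C : A → Set} {_⊏_ : A → A → Set}
           (comparable : ∀ {x y} → C x → C y → x ≢ y → x ⊏ y ⊎ y ⊏ x) where

    atMost-1 : (∀ {x y} → C x → C y → ¬ x ⊏ y) → AtMost 1 C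
    atMost-1 _ {[]} _ _ = z≤n
    atMost-1 _ {_ ∷ []} _ _ = s≤s z≤n
    atMost-1 ¬chain {_ ∷ _ ∷ _} ((x≢y ∷ _) ∷ _) (cx ∷ cy ∷ _) with comparable cx cy x≢y
    ... | inj₁ x⊏y = contradiction x⊏y (¬chain cx cy)
    ... | inj₂ y⊏x = contradiction y⊏x (¬chain cy cx)

    -- Every tournament on three vertices has a directed path through all of them, so it is enough
    -- to exclude such paths.
    atMost-2 : (∀ {x y z} → C x → C y → C z → x ⊏ y → ¬ y ⊏ z) → AtMost 2 C
    atMost-2 _ {[]} _ _ = z≤n
    atMost-2 _ {_ ∷ []} _ _ = s≤s z≤n
    atMost-2 _ {_ ∷ _ ∷ []} _ _ = s≤s (s≤s z≤n)
    atMost-2 ¬chain {_ ∷ _ ∷ _ ∷ _} ((x≢y ∷ x≢z ∷ _) ∷ (y≢z ∷ _) ∷ _) (cx ∷ cy ∷ cz ∷ _)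
      with comparable cx cy x≢y | comparable cy cz y≢z | comparable cx cz x≢z
    ... | inj₁ x⊏y | inj₁ y⊏z | _        = contradiction y⊏z (¬chain cx cy cz x⊏y)
    ... | inj₁ x⊏y | inj₂ z⊏y | inj₁ x⊏z = contradiction z⊏y (¬chain cx cz cy x⊏z)
    ... | inj₁ x⊏y | inj₂ z⊏y | inj₂ z⊏x = contradiction x⊏y (¬chain cz cx cy z⊏x)
    ... | inj₂ y⊏x | inj₁ y⊏z | inj₁ x⊏z = contradiction x⊏z (¬chain cy cx cz y⊏x)
    ... | inj₂ y⊏x | inj₁ y⊏z | inj₂ z⊏x = contradiction z⊏x (¬chain cy cz cx y⊏z)
    ... | inj₂ y⊏x | inj₂ z⊏y | _        = contradiction y⊏x (¬chain cz cy cx z⊏y)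

  atMost-∪ : ∀ {j k C D E} → AtMost j C → AtMost k D → (∀ {x} → E x → C x ⊎ D x) →
             AtMost (j ℕ.+ k) E
  atMost-∪ {j} {k} {C} {D} {E} atMost-C atMost-D E⊆C∪D {xs} unique all =
    let cs , ds , _ , _ , unique-cs , unique-ds , all-C , all-D , eq = split unique all
    in subst (ℕ._≤ j ℕ.+ k) (sym eq)
         (ℕ.+-mono-≤ (atMost-C unique-cs all-C) (atMost-D unique-ds all-D))
    where
    -- The sublist proofs show that the head is still fresh in the part that receives it.
    split : ∀ {xs} → Unique xs → All E xs →
      ∃[ cs ] ∃[ ds ] cs ⊆ xs × ds ⊆ xs × Unique cs × Unique ds × All C cs × All D ds ×
        length xs ≡ length cs ℕ.+ length ds
    split [] [] = [] , [] , [] , [] , [] , [] , [] , [] , refl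
    split {x ∷ xs} (x∉xs ∷ unique) (e ∷ all)
      with cs , ds , cs⊆ , ds⊆ , ucs , uds , acs , ads , eq ← split unique all | E⊆C∪D e
    ... | inj₁ c = x ∷ cs , ds , refl ∷ cs⊆ , x ∷ʳ ds⊆ , All-resp-⊆ cs⊆ x∉xs ∷ ucs , uds ,
                   c ∷ acs , ads , cong suc eq
    ... | inj₂ d = cs , x ∷ ds , x ∷ʳ cs⊆ , refl ∷ ds⊆ , ucs , All-resp-⊆ ds⊆ x∉xs ∷ uds ,
                   acs , d ∷ ads , trans (cong suc eq) (sym (ℕ.+-suc (length cs) (length ds)))

-- Serves twice: for the nearest square along a line, and for the nearest end of a side.
minimal : ∀ {A : Set} {_≤_ : A → A → Set} → (∀ x y → x ≤ y ⊎ y ≤ x) →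
  (∀ {x y z} → x ≤ y → y ≤ z → x ≤ z) → ∀ {R : A → Set} → Decidable R → ∀ xs →
  All (¬_ ∘ R) xs ⊎ ∃[ u ] R u × All (λ w → R w → u ≤ w) xs
minimal total ≤-trans R? [] = inj₁ []
minimal total ≤-trans R? (x ∷ xs) with R? x | minimal total ≤-trans R? xs
... | no ¬r | inj₁ none = inj₁ (¬r ∷ none)
... | no ¬r | inj₂ (u , r , least) = inj₂ (u , r , flip contradiction ¬r ∷ least)
... | yes r | inj₁ none =
  inj₂ (x , r , (λ _ → [ id , id ]′ (total x x)) ∷ All.map (λ ¬r r′ → contradiction r′ ¬r) none)
... | yes r | inj₂ (u , r′ , least) with total x u
...   | inj₁ x≤u = inj₂ (x , r , (λ _ → [ id , id ]′ (total x x)) ∷ All.map (≤-trans x≤u ∘_) least)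
...   | inj₂ u≤x = inj₂ (u , r′ , (λ _ → u≤x) ∷ least)

-- Unit intervals

data Cell (V : Set) : Set where
  low high : V → Cell V

-- Intervals [ c v , c v + 1 ]: u ≲ v means c u ≤ c v, and u ≺ v means c u + 1 ≤ c v.
record Axis (V : Set) : Set₁ where
  infix 4 _≲_ _≺_ _≬_ _∋_
  field
    _≲_ _≺_ : V → V → Set
    _≲?_ : ∀ u v → Dec (u ≲ v)
    _≺?_ : ∀ u v → Dec (u ≺ v)
    ≲-total : ∀ u v → u ≲ v ⊎ v ≲ u
    ≲-trans : ∀ {u v w} → u ≲ v → v ≲ w → u ≲ w
    ≺-≲-trans : ∀ {u v w} → u ≺ v → v ≲ w → u ≺ w
    ≲-≺-trans : ∀ {u v w} → u ≲ v → v ≺ w → u ≺ w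
    ≺⇒⋦ : ∀ {u v} → u ≺ v → ¬ v ≲ u

  ≲-refl : ∀ {v} → v ≲ v
  ≲-refl {v} = [ id , id ]′ (≲-total v v)

  ⋦⇒≲ : ∀ {u v} → ¬ u ≲ v → v ≲ u
  ⋦⇒≲ {u} {v} u⋦v = [ flip contradiction u⋦v , id ]′ (≲-total u v)

  ≺⇒≲ : ∀ {u v} → u ≺ v → u ≲ v
  ≺⇒≲ = ⋦⇒≲ ∘ ≺⇒⋦

  ≺-trans : ∀ {u v w} → u ≺ v → v ≺ w → u ≺ w
  ≺-trans u≺v v≺w = ≺-≲-trans u≺v (≺⇒≲ v≺w)

  ≺-irrefl : ∀ {v} → ¬ v ≺ v
  ≺-irrefl v≺v = ≺⇒⋦ v≺v ≲-refl

  ≺⇒≢ : ∀ {u v} → u ≺ v → u ≢ v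
  ≺⇒≢ u≺u refl = ≺-irrefl u≺u

  -- This is where equal lengths matter: an interval no longer than `v` cannot overlap both `u` and
  -- `w` when `v` fits between them.
  semiorder : ∀ {u v w} → u ≺ v → v ≺ w → ∀ x → u ≺ x ⊎ x ≺ w
  semiorder {v = v} u≺v v≺w x =
    Sum.map (≺-≲-trans u≺v) (flip ≲-≺-trans v≺w) (≲-total v x)

  _≬_ : V → V → Set
  u ≬ v = ¬ u ≺ v × ¬ v ≺ u

  ≬-sym : ∀ {u v} → u ≬ v → v ≬ u
  ≬-sym (u⊀v , v⊀u) = v⊀u , u⊀v

  ≬-refl : ∀ {v} → v ≬ v
  ≬-refl = ≺-irrefl , ≺-irrefl

  -- low v is a short interval just above the lower end of v, and high v one
  -- just below its upper end; c ∋ v says that v covers the cell c.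
  _∋_ : Cell V → V → Set
  low  v ∋ w = w ≲ v × ¬ w ≺ v
  high v ∋ w = v ≲ w × ¬ v ≺ w

  _∋?_ : ∀ c v → Dec (c ∋ v)
  low  v ∋? w = w ≲? v ×-dec ¬? (w ≺? v)
  high v ∋? w = v ≲? w ×-dec ¬? (v ≺? w)

  low∋ : ∀ v → low v ∋ v
  low∋ v = ≲-refl , ≺-irrefl

  high∋ : ∀ v → high v ∋ v
  high∋ v = ≲-refl , ≺-irrefl

  ∋⇒⊀ : ∀ c {u w} → c ∋ u → c ∋ w → ¬ u ≺ w
  ∋⇒⊀ (low v)  (_ , u⊀v) (w≲v , _) u≺w = u⊀v (≺-≲-trans u≺w w≲v)
  ∋⇒⊀ (high v) (v≲u , _) (_ , v⊀w) u≺w = v⊀w (≲-≺-trans v≲u u≺w)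

  ∋⇒≬ : ∀ c {u w} → c ∋ u → c ∋ w → u ≬ w
  ∋⇒≬ c c∋u c∋w = ∋⇒⊀ c c∋u c∋w , ∋⇒⊀ c c∋w c∋u

  Above Below : V → V → V → Set
  Above v w u = ¬ u ≲ v × ¬ u ≲ w
  Below v w u = ¬ v ≲ u × ¬ w ≲ u

-- Reversal exchanges `low` with `high` and `Above` with `Below`.
reverse : ∀ {V} → Axis V → Axis V
reverse A = record
  { _≲_ = flip _≲_ ; _≺_ = flip _≺_ ; _≲?_ = flip _≲?_ ; _≺?_ = flip _≺?_
  ; ≲-total = flip ≲-total ; ≲-trans = flip ≲-trans
  ; ≺-≲-trans = flip ≲-≺-trans ; ≲-≺-trans = flip ≺-≲-trans ; ≺⇒⋦ = ≺⇒⋦ }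
  where open Axis A

-- What bands of visibility in the direction of X amount to for squares with
-- projections X and Y.  In obstacles, a band passes u and u′ on the same side,
-- since u ≬ u′ leaves no room between them.
record Scan {V : Set} (X Y : Axis V) : Set₂ where
  private
    module X = Axis X
    module Y = Axis Y
  field
    Sees : V → V → Set₁
    Sees-sym : ∀ {v w} → Sees v w → Sees w v
    Sees⇒≬ : ∀ {v w} → Sees v w → v Y.≬ w
    obstacles : ∀ {v w u u′} → Sees v w → v X.≺ u → u X.≺ w → v X.≺ u′ → u′ X.≺ w →
      u Y.≬ u′ → (Y.Above v w u × Y.Above v w u′) ⊎ (Y.Below v w u × Y.Below v w u′)
    consecutive : ∀ c {v w} → c Y.∋ v → c Y.∋ w → v X.≺ w →
      (∀ u → c Y.∋ u → v X.≺ u → ¬ u X.≺ w) → Sees v w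

-- Layouts of unit squares and their symmetries

record Layout (V : Set) : Set₂ where
  field
    X Y : Axis V
    horizontal : Scan X Y
    vertical : Scan Y X
    vertices : List V
    complete : ∀ v → v ∈ vertices
    side : V → Bool
  module X = Axis X
  module Y = Axis Y
  module H = Scan horizontal
  module Vt = Scan vertical
  field
    interiors-disjoint : ∀ {v w} → v ≢ w → v X.≬ w → ¬ v Y.≬ w
    adjacent⇒sees : ∀ {v w} → side v ≡ not (side w) → H.Sees v w ⊎ Vt.Sees v w
    sees⇒adjacent : ∀ {v w} → v ≢ w → H.Sees v w ⊎ Vt.Sees v w → side v ≡ not (side w)

transpose : ∀ {V} → Layout V → Layout V
transpose L = record
  { X = Y ; Y = X ; horizontal = vertical ; vertical = horizontal
  ; vertices = vertices ; complete = complete ; side = side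
  ; interiors-disjoint = λ v≢w y x → interiors-disjoint v≢w x y
  ; adjacent⇒sees = Sum.swap ∘ adjacent⇒sees
  ; sees⇒adjacent = λ v≢w → sees⇒adjacent v≢w ∘ Sum.swap }
  where open Layout L

-- Horizontal bands are read from the other end; for vertical bands the two sides on which an
-- obstacle can be passed are exchanged.
reflect : ∀ {V} → Layout V → Layout V
reflect {V} L = record
  { X = reverse X ; Y = Y
  ; horizontal = record
    { Sees = H.Sees ; Sees-sym = H.Sees-sym ; Sees⇒≬ = H.Sees⇒≬
    ; obstacles = λ s a b a′ b′ o → Sum.map (λ (h , h′) → swap h , swap h′) (λ (h , h′) → swap h , swap h′)
        (H.obstacles (H.Sees-sym s) b a b′ a′ o)
    ; consecutive = λ c v w v≺w none →
        H.Sees-sym (H.consecutive c w v v≺w (λ u c∋u a b → none u c∋u b a)) }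
  ; vertical = record
    { Sees = Vt.Sees ; Sees-sym = Vt.Sees-sym ; Sees⇒≬ = X.≬-sym ∘ Vt.Sees⇒≬
    ; obstacles = λ s a b a′ b′ o → Sum.swap (Vt.obstacles s a b a′ b′ (X.≬-sym o))
    ; consecutive = λ { (low v) → Vt.consecutive (high v) ; (high v) → Vt.consecutive (low v) } }
  ; vertices = vertices ; complete = complete ; side = side
  ; interiors-disjoint = λ v≢w → interiors-disjoint v≢w ∘ X.≬-sym
  ; adjacent⇒sees = adjacent⇒sees
  ; sees⇒adjacent = sees⇒adjacent }
  where open Layout L

-- Alternation along a line and forbidden patterns

module LayoutProperties {V : Set} (L : Layout V) where
  open Layout L

  IsP IsQ : V → Set
  IsP v = side v ≡ false
  IsQ v = side v ≡ true

  Q≢P : ∀ {q p} → IsQ q → IsP p → q ≢ p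
  Q≢P q p refl with () ← trans (sym q) p

  P-adjacent-Q : ∀ {p q} → IsP p → IsQ q → side p ≡ not (side q)
  P-adjacent-Q p q = trans p (cong not (sym q))

  -- The square nearest to `a` on its right in the cell sees `a`, hence has the opposite side. If
  -- none came before `b`, then `a` and `b` would see each other.
  alternate : ∀ c {a b} → c Y.∋ a → c Y.∋ b → a X.≺ b → side a ≡ side b →
    ∃[ u ] c Y.∋ u × a X.≺ u × u X.≺ b × side u ≡ not (side a)
  alternate c {a} {b} c∋a c∋b a≺b same
    with minimal X.≲-total X.≲-trans
           (λ u → (c Y.∋? u) ×-dec ((a X.≺? u) ×-dec (u X.≺? b))) vertices
  ... | inj₁ none = contradiction
          (sees⇒adjacent (X.≺⇒≢ a≺b) (inj₁ (H.consecutive c c∋a c∋b a≺b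
            λ u c∋u a≺u u≺b → All.lookup none (complete u) (c∋u , a≺u , u≺b))))
          (not-¬ same)
  ... | inj₂ (u , (c∋u , a≺u , u≺b) , least) = u , c∋u , a≺u , u≺b ,
          trans (sym (not-involutive (side u))) (cong not (sym (sees⇒adjacent (X.≺⇒≢ a≺u)
            (inj₁ (H.consecutive c c∋a c∋u a≺u λ w c∋w a≺w w≺u →
              X.≺⇒⋦ w≺u (All.lookup least (complete w) (c∋w , a≺w , X.≺-trans w≺u u≺b)))))))

  ≬⇒comparable : ∀ {u w} → u ≢ w → u Y.≬ w → u X.≺ w ⊎ w X.≺ u
  ≬⇒comparable {u} {w} u≢w y with u X.≺? w | w X.≺? u
  ... | yes u≺w | _ = inj₁ u≺w
  ... | no _ | yes w≺u = inj₂ w≺u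
  ... | no u⊀w | no w⊀u = contradiction y (interiors-disjoint u≢w (u⊀w , w⊀u))

  P-between : ∀ c {a b} → IsQ a → IsQ b → c Y.∋ a → c Y.∋ b → a X.≺ b →
              ∃[ p ] IsP p × c Y.∋ p × a X.≺ p × p X.≺ b
  P-between c Qa Qb ∋a ∋b a≺b =
    let p , ∋p , a≺p , p≺b , Pp = alternate c ∋a ∋b a≺b (trans Qa (sym Qb))
    in p , trans Pp (cong not Qa) , ∋p , a≺p , p≺b

  cell-comparable : ∀ c {q q′} → c Y.∋ q → c Y.∋ q′ → q ≢ q′ → q X.≺ q′ ⊎ q′ X.≺ q
  cell-comparable c c∋q c∋q′ q≢q′ = ≬⇒comparable q≢q′ (Y.∋⇒≬ c c∋q c∋q′)

  ≬⇒comparableʸ : ∀ {u w} → u ≢ w → u X.≬ w → u Y.≺ w ⊎ w Y.≺ u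
  ≬⇒comparableʸ {u} {w} u≢w x with u Y.≺? w | w Y.≺? u
  ... | yes u≺w | _ = inj₁ u≺w
  ... | no _ | yes w≺u = inj₂ w≺u
  ... | no u⊀w | no w⊀u = contradiction (u⊀w , w⊀u) (interiors-disjoint u≢w x)

  -- Vertical sight is excluded because the columns of `v` and `w` do not overlap.
  ≺⇒sees : ∀ {v w} → side v ≡ not (side w) → v X.≺ w → H.Sees v w
  ≺⇒sees adj v≺w with adjacent⇒sees adj
  ... | inj₁ h = h
  ... | inj₂ vt = contradiction v≺w (proj₁ (Vt.Sees⇒≬ vt))

  obstacle : ∀ {v w u} → H.Sees v w → v X.≺ u → u X.≺ w → Y.Above v w u ⊎ Y.Below v w u
  obstacle s v≺u u≺w = Sum.map proj₁ proj₁ (H.obstacles s v≺u u≺w v≺u u≺w Y.≬-refl)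

  -- The band from `a` to `d` passes `b` and `c` on the same side since these share a row. The bands
  -- from `a` to `c` and from `b` to `d` then each force one of `b`, `c` to be strictly beyond the
  -- other.
  no-aabb : ∀ {a b c d} → a X.≺ b → b X.≺ c → c X.≺ d → b Y.≬ c →
    side a ≡ side b → side c ≡ side d → ¬ side b ≡ not (side c)
  no-aabb {a} {b} {c} {d} a≺b b≺c c≺d b≬c a≡b c≡d b≡¬c =
    conclude (H.obstacles a-sees-d a≺b (X.≺-trans b≺c c≺d) (X.≺-trans a≺b b≺c) c≺d b≬c)
             (obstacle a-sees-c a≺b b≺c) (obstacle b-sees-d b≺c c≺d)
    where
    a-sees-d : H.Sees a d
    a-sees-d = ≺⇒sees (trans a≡b (trans b≡¬c (cong not c≡d))) (X.≺-trans a≺b (X.≺-trans b≺c c≺d))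
    a-sees-c : H.Sees a c
    a-sees-c = ≺⇒sees (trans a≡b b≡¬c) (X.≺-trans a≺b b≺c)
    b-sees-d : H.Sees b d
    b-sees-d = ≺⇒sees (trans b≡¬c (cong not c≡d)) (X.≺-trans b≺c c≺d)

    conclude : (Y.Above a d b × Y.Above a d c) ⊎ (Y.Below a d b × Y.Below a d c) →
               Y.Above a c b ⊎ Y.Below a c b → ¬ (Y.Above b d c ⊎ Y.Below b d c)
    -- The essential case: `b` is strictly higher than `c`, and `c` strictly higher than `b`.
    conclude (inj₁ _)             (inj₁ (_ , b⋦c)) (inj₁ (c⋦b , _)) = c⋦b (Y.⋦⇒≲ b⋦c)
    conclude (inj₁ (_ , _ , c⋦d)) (inj₁ _)         (inj₂ (_ , d⋦c)) = d⋦c (Y.⋦⇒≲ c⋦d)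
    conclude (inj₁ ((b⋦a , _) , _)) (inj₂ (a⋦b , _)) _              = a⋦b (Y.⋦⇒≲ b⋦a)
    conclude (inj₂ ((a⋦b , _) , _)) (inj₁ (b⋦a , _)) _              = b⋦a (Y.⋦⇒≲ a⋦b)
    conclude (inj₂ (_ , _ , d⋦c)) (inj₂ _)         (inj₁ (_ , c⋦d)) = c⋦d (Y.⋦⇒≲ d⋦c)
    conclude (inj₂ _)             (inj₂ (_ , c⋦b)) (inj₂ (b⋦c , _)) = b⋦c (Y.⋦⇒≲ c⋦b)

  -- Two vertices of P in a common row

  module TwoInRow {v p} (Pv : IsP v) (Pp : IsP p)
                  (v≺p : v X.≺ p) (v≬p : v Y.≬ p) (v≲p : v Y.≲ p) where

    -- A whole square fits between `v` and `p`, so by `semiorder` no square meets the columns of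
    -- both.
    gap : ∃[ g ] v X.≺ g × g X.≺ p
    gap = let g , _ , v≺g , g≺p , _ = alternate (low p) (v≲p , proj₁ v≬p) (Y.low∋ p) v≺p
                                        (trans Pv (sym Pp))
          in g , v≺g , g≺p

    -- Four classes covering Q, with bounds 1, 1, 2 and 2. The first two hold the vertices seen
    -- vertically from `v` or from `p`, the others those seen horizontally from both.
    OverV OverP TopLeft BottomRight : V → Set
    OverV q = IsQ q × v X.≬ q × p Y.≬ q
    OverP q = IsQ q × p X.≬ q × v Y.≬ q
    TopLeft q = IsQ q × high v Y.∋ q × q X.≺ p
    BottomRight q = IsQ q × low p Y.∋ q × v X.≺ q

    -- In the column of `v`, `q` lies above or below `v`. Below, it would miss the rows of `p`;
    -- above, it reaches the topmost row of `p`. Hence all such `q` share one cell.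
    OverV⇒high : ∀ {q} → OverV q → high p Y.∋ q
    OverV⇒high (Qq , x , y) with ≬⇒comparableʸ (≢-sym (Q≢P Qq Pv)) x
    ... | inj₁ v≺q = Y.⋦⇒≲ (λ q≲p → proj₁ v≬p (Y.≺-≲-trans v≺q q≲p)) , proj₁ y
    ... | inj₂ q≺v = contradiction (Y.≺-≲-trans q≺v v≲p) (proj₂ y)

    OverP⇒low : ∀ {q} → OverP q → low v Y.∋ q
    OverP⇒low (Qq , x , y) with ≬⇒comparableʸ (≢-sym (Q≢P Qq Pp)) x
    ... | inj₁ p≺q = contradiction (Y.≲-≺-trans v≲p p≺q) (proj₁ y)
    ... | inj₂ q≺p = Y.⋦⇒≲ (λ v≲q → proj₁ v≬p (Y.≲-≺-trans v≲q q≺p)) , proj₂ y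

    -- A vertex of P fits between `q` and `q′`, so by `semiorder` the column of `w` cannot overlap
    -- both.
    squeezed : ∀ c {w q q′} → IsQ q → IsQ q′ → c Y.∋ q → c Y.∋ q′ →
               w X.≬ q → w X.≬ q′ → ¬ q X.≺ q′
    squeezed c {w} Qq Qq′ c∋q c∋q′ w≬q w≬q′ q≺q′
      with u , _ , _ , q≺u , u≺q′ ← P-between c Qq Qq′ c∋q c∋q′ q≺q′
      with X.semiorder q≺u u≺q′ w
    ... | inj₁ q≺w = proj₂ w≬q q≺w
    ... | inj₂ w≺q′ = proj₁ w≬q′ w≺q′

    atMost-OverV : AtMost 1 OverV
    atMost-OverV = atMost-1
      (λ q q′ → cell-comparable (high p) (OverV⇒high q) (OverV⇒high q′))
      (λ q@(Qq , x , _) q′@(Qq′ , x′ , _) →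
        squeezed (high p) Qq Qq′ (OverV⇒high q) (OverV⇒high q′) x x′)

    atMost-OverP : AtMost 1 OverP
    atMost-OverP = atMost-1
      (λ q q′ → cell-comparable (low v) (OverP⇒low q) (OverP⇒low q′))
      (λ q@(Qq , x , _) q′@(Qq′ , x′ , _) →
        squeezed (low v) Qq Qq′ (OverP⇒low q) (OverP⇒low q′) x x′)

    -- Three such vertices `a`, `b`, `c` would give some `u` in P between `b` and `c`, and then `a`,
    -- `b`, `u`, `p` is the pattern excluded by `no-aabb`.
    atMost-TopLeft : AtMost 2 TopLeft
    atMost-TopLeft = atMost-2
      (λ (_ , ∋q , _) (_ , ∋q′ , _) → cell-comparable (high v) ∋q ∋q′)
      λ (Qa , _ , _) (Qb , ∋b , _) (Qc , ∋c , c≺p) a≺b b≺c →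
        let u , Pu , ∋u , b≺u , u≺c = P-between (high v) Qb Qc ∋b ∋c b≺c
        in no-aabb a≺b b≺u (X.≺-trans u≺c c≺p) (Y.∋⇒≬ (high v) ∋b ∋u)
             (trans Qa (sym Qb)) (trans Pu (sym Pp)) (trans Qb (cong not (sym Pu)))

    atMost-BottomRight : AtMost 2 BottomRight
    atMost-BottomRight = atMost-2
      (λ (_ , ∋q , _) (_ , ∋q′ , _) → cell-comparable (low p) ∋q ∋q′)
      λ (Qa , ∋a , v≺a) (Qb , ∋b , _) (Qc , _ , _) a≺b b≺c →
        let u , Pu , ∋u , a≺u , u≺b = P-between (low p) Qa Qb ∋a ∋b a≺b
        in no-aabb (X.≺-trans v≺a a≺u) u≺b b≺c (Y.∋⇒≬ (low p) ∋u ∋b)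
             (trans Pv (sym Pu)) (trans Qb (sym Qc)) (P-adjacent-Q Pu Qb)

    -- If `q` is left of `v`, it sees `p` past `v`; the band cannot pass below `v`, as `v` is not
    -- higher than `p`, so it passes above and `q` reaches the top of `v`. Beyond `p` the argument
    -- is symmetric, and in between the heights of `q` and `p` decide.
    classify-row : ∀ {q} → IsQ q → v Y.≬ q → p Y.≬ q → H.Sees v q → H.Sees p q →
                   TopLeft q ⊎ BottomRight q
    classify-row {q} Qq v≬q p≬q v-sees-q p-sees-q
      with ≬⇒comparable (≢-sym (Q≢P Qq Pv)) v≬q | ≬⇒comparable (≢-sym (Q≢P Qq Pp)) p≬q
    ... | inj₂ q≺v | _ with obstacle (H.Sees-sym p-sees-q) q≺v v≺p
    ...   | inj₁ (_ , v⋦p) = contradiction v≲p v⋦p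
    ...   | inj₂ (q⋦v , _) = inj₁ (Qq , (Y.⋦⇒≲ q⋦v , proj₁ v≬q) , X.≺-trans q≺v v≺p)
    classify-row {q} Qq v≬q p≬q v-sees-q p-sees-q | inj₁ v≺q | inj₁ p≺q
      with obstacle v-sees-q v≺p p≺q
    ... | inj₁ (_ , p⋦q) = inj₂ (Qq , (Y.⋦⇒≲ p⋦q , proj₂ p≬q) , v≺q)
    ... | inj₂ (v⋦p , _) = contradiction v≲p v⋦p
    classify-row {q} Qq v≬q p≬q v-sees-q p-sees-q | inj₁ v≺q | inj₂ q≺p with Y.≲-total q p
    ... | inj₁ q≲p = inj₂ (Qq , (q≲p , proj₂ p≬q) , v≺q)
    ... | inj₂ p≲q = inj₁ (Qq , (Y.≲-trans v≲p p≲q , proj₁ v≬q) , q≺p)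

    classify : ∀ {q} → IsQ q → (OverV q ⊎ OverP q) ⊎ (TopLeft q ⊎ BottomRight q)
    classify {q} Qq with adjacent⇒sees (P-adjacent-Q Pv Qq) | adjacent⇒sees (P-adjacent-Q Pp Qq)
    ... | inj₁ h | inj₁ h′ = inj₂ (classify-row Qq (H.Sees⇒≬ h) (H.Sees⇒≬ h′) h h′)
    ... | inj₁ h | inj₂ s = inj₁ (inj₂ (Qq , Vt.Sees⇒≬ s , H.Sees⇒≬ h))
    ... | inj₂ s | inj₁ h = inj₁ (inj₁ (Qq , Vt.Sees⇒≬ s , H.Sees⇒≬ h))
    ... | inj₂ s | inj₂ s′ with X.semiorder (proj₁ (proj₂ gap)) (proj₂ (proj₂ gap)) q
    ...   | inj₁ v≺q = contradiction v≺q (proj₁ (Vt.Sees⇒≬ s))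
    ...   | inj₂ q≺p = contradiction q≺p (proj₂ (Vt.Sees⇒≬ s′))

    atMost-Q : AtMost 6 IsQ
    atMost-Q = atMost-∪ (atMost-∪ atMost-OverV atMost-OverP id)
                        (atMost-∪ atMost-TopLeft atMost-BottomRight id) classify

  -- A vertex of P sharing no row with another one

  module AloneInRow {v} (Pv : IsP v) (alone : ∀ {p} → IsP p → p ≢ v → ¬ p Y.≬ v) where

    Left Right : Cell V → V → Set
    Left  c q = IsQ q × c Y.∋ q × q X.≺ v
    Right c q = IsQ q × c Y.∋ q × v X.≺ q

    -- Two of them would enclose a vertex of P in the cell `c`, which would share a row with `v`.
    atMost-Left : ∀ c → c Y.∋ v → AtMost 1 (Left c)
    atMost-Left c ∋v = atMost-1
      (λ (_ , ∋q , _) (_ , ∋q′ , _) → cell-comparable c ∋q ∋q′)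
      λ (Qa , ∋a , _) (Qb , ∋b , b≺v) a≺b →
        let p , Pp , ∋p , _ , p≺b = P-between c Qa Qb ∋a ∋b a≺b
        in alone Pp (X.≺⇒≢ (X.≺-trans p≺b b≺v)) (Y.∋⇒≬ c ∋p ∋v)

    atMost-Right : ∀ c → c Y.∋ v → AtMost 1 (Right c)
    atMost-Right c ∋v = atMost-1
      (λ (_ , ∋q , _) (_ , ∋q′ , _) → cell-comparable c ∋q ∋q′)
      λ (Qa , ∋a , v≺a) (Qb , ∋b , _) a≺b →
        let p , Pp , ∋p , a≺p , _ = P-between c Qa Qb ∋a ∋b a≺b
        in alone Pp (≢-sym (X.≺⇒≢ (X.≺-trans v≺a a≺p))) (Y.∋⇒≬ c ∋p ∋v)

    -- Vertices level with `v` count as down, so the upper classes are strictly higher than `v` and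
    -- reach rows beyond its top.
    LU LD RU RD : V → Set
    LU q = Left (high v) q × ¬ q Y.≲ v
    LD q = Left (low v) q
    RU q = Right (high v) q × ¬ q Y.≲ v
    RD q = Right (low v) q

    -- The vertex of P met between A and C in a row above v would have to reach
    -- both B and D in a vertical direction, although v separates these two.
    not-all-four : ∀ {a b c d} → LU a → LD b → RU c → ¬ RD d
    not-all-four {a} {b} {c} {d} ((Qa , (v≲a , v⊀a) , a≺v) , a⋦v) (Qb , (b≲v , _) , b≺v)
                 ((Qc , (v≲c , v⊀c) , v≺c) , c⋦v) (Qd , (d≲v , _) , v≺d) =
      let p , Pp , v≺p = P-above-v
      in [ flip contradiction (proj₂ (Q-below-v⇒≬ Pp v≺p Qb b≲v))
         , flip contradiction (proj₁ (Q-below-v⇒≬ Pp v≺p Qd d≲v))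
         ]′ (X.semiorder b≺v v≺d p)
      where
      P-in-cell : ∀ e → e Y.∋ a → e Y.∋ c → (∀ {u} → e Y.∋ u → ¬ u Y.≲ v) →
                  ∃[ p ] IsP p × v Y.≺ p
      P-in-cell e ∋a ∋c ∋⇒⋦v
        with p , Pp , ∋p , _ ← P-between e Qa Qc ∋a ∋c (X.≺-trans a≺v v≺c)
        with v Y.≺? p
      ... | yes v≺p = p , Pp , v≺p
      ... | no v⊀p = contradiction ((λ p≺v → ∋⇒⋦v ∋p (Y.≺⇒≲ p≺v)) , v⊀p)
                       (alone Pp (λ { refl → ∋⇒⋦v ∋p Y.≲-refl }))

      P-above-v : ∃[ p ] IsP p × v Y.≺ p
      P-above-v with Y.≲-total a c
      -- The topmost row of the lower of `a` and `c` meets both and runs above the top of `v`.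
      ... | inj₁ a≲c = P-in-cell (high a) (Y.high∋ a) (a≲c , λ a≺c → v⊀c (Y.≲-≺-trans v≲a a≺c))
                         (λ (a≲u , _) u≲v → a⋦v (Y.≲-trans a≲u u≲v))
      ... | inj₂ c≲a = P-in-cell (high c) (c≲a , λ c≺a → v⊀a (Y.≲-≺-trans v≲c c≺a)) (Y.high∋ c)
                         (λ (c≲u , _) u≲v → c⋦v (Y.≲-trans c≲u u≲v))

      Q-below-v⇒≬ : ∀ {p q} → IsP p → v Y.≺ p → IsQ q → q Y.≲ v → p X.≬ q
      Q-below-v⇒≬ Pp v≺p Qq q≲v with adjacent⇒sees (P-adjacent-Q Pp Qq)
      ... | inj₁ h = contradiction (Y.≲-≺-trans q≲v v≺p) (proj₂ (H.Sees⇒≬ h))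
      ... | inj₂ s = Vt.Sees⇒≬ s

    Row : V → Set
    Row q = IsQ q × v Y.≬ q

    classify : ∀ {q} → Row q → (LU q ⊎ LD q) ⊎ (RU q ⊎ RD q)
    classify {q} (Qq , v⊀q , q⊀v) with q Y.≲? v | ≬⇒comparable (Q≢P Qq Pv) (q⊀v , v⊀q)
    ... | yes q≲v | inj₁ q≺v = inj₁ (inj₂ (Qq , (q≲v , q⊀v) , q≺v))
    ... | yes q≲v | inj₂ v≺q = inj₂ (inj₂ (Qq , (q≲v , q⊀v) , v≺q))
    ... | no q⋦v | inj₁ q≺v = inj₁ (inj₁ ((Qq , (Y.⋦⇒≲ q⋦v , v⊀q) , q≺v) , q⋦v))
    ... | no q⋦v | inj₂ v≺q = inj₂ (inj₁ ((Qq , (Y.⋦⇒≲ q⋦v , v⊀q) , v≺q) , q⋦v))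

    lu : AtMost 1 LU
    lu u = atMost-Left (high v) (Y.high∋ v) u ∘ All.map proj₁

    ld : AtMost 1 LD
    ld = atMost-Left (low v) (Y.low∋ v)

    ru : AtMost 1 RU
    ru u = atMost-Right (high v) (Y.high∋ v) u ∘ All.map proj₁

    rd : AtMost 1 RD
    rd = atMost-Right (low v) (Y.low∋ v)

    empty? : ∀ {C : V → Set} → Decidable C → AtMost 0 C ⊎ ∃ C
    empty? C? with any? C? vertices
    ... | yes c = inj₂ (satisfied c)
    ... | no ¬c = inj₁ (atMost-0 λ {x} c → ¬c (lose (complete x) c))

    left? : ∀ c → Decidable (Left c)
    left? c q = (side q ≟ true) ×-dec ((c Y.∋? q) ×-dec (q X.≺? v))

    right? : ∀ c → Decidable (Right c)
    right? c q = (side q ≟ true) ×-dec ((c Y.∋? q) ×-dec (v X.≺? q))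

    -- Each of the four classes has at most one member, and one class is empty by `not-all-four`.
    atMost-Row : AtMost 3 Row
    atMost-Row
      with empty? (λ q → left? (high v) q ×-dec ¬? (q Y.≲? v)) | empty? (left? (low v))
         | empty? (λ q → right? (high v) q ×-dec ¬? (q Y.≲? v)) | empty? (right? (low v))
    ... | inj₁ no-LU | _ | _ | _ = atMost-∪ (atMost-∪ no-LU ld id) (atMost-∪ ru rd id) classify
    ... | inj₂ _ | inj₁ no-LD | _ | _ = atMost-∪ (atMost-∪ lu no-LD id) (atMost-∪ ru rd id) classify
    ... | inj₂ _ | inj₂ _ | inj₁ no-RU | _ = atMost-∪ (atMost-∪ lu ld id) (atMost-∪ no-RU rd id) classify
    ... | inj₂ _ | inj₂ _ | inj₂ _ | inj₁ no-RD = atMost-∪ (atMost-∪ lu ld id) (atMost-∪ ru no-RD id) classify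
    ... | inj₂ (_ , a) | inj₂ (_ , b) | inj₂ (_ , c) | inj₂ (_ , d) = contradiction d (not-all-four a b c)

-- The bound on Q

module _ {V : Set} where
  open LayoutProperties

  -- Reflection and exchange of the two vertices arrange that the left one is not higher.
  crowded-row : (L : Layout V) → ∀ {v p} → IsP L v → IsP L p → p ≢ v →
                Axis._≬_ (Layout.Y L) p v → AtMost 6 (IsQ L)
  crowded-row L {v} {p} Pv Pp p≢v p≬v
    with Y.≲-total v p | ≬⇒comparable L p≢v p≬v
    where open Layout L
  ... | inj₁ v≲p | inj₁ p≺v = TwoInRow.atMost-Q (reflect L) Pv Pp p≺v (Axis.≬-sym (Layout.Y L) p≬v) v≲p
  ... | inj₁ v≲p | inj₂ v≺p = TwoInRow.atMost-Q L Pv Pp v≺p (Axis.≬-sym (Layout.Y L) p≬v) v≲p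
  ... | inj₂ p≲v | inj₁ p≺v = TwoInRow.atMost-Q L Pp Pv p≺v p≬v p≲v
  ... | inj₂ p≲v | inj₂ v≺p = TwoInRow.atMost-Q (reflect L) Pp Pv v≺p p≬v p≲v

  too-many-Q : (L : Layout V) → ∀ {v} → IsP L v → ¬ ¬ AtMost 6 (IsQ L)
  too-many-Q L {v} Pv k =
    ¬¬-excluded-middle λ row → ¬¬-excluded-middle λ column → k (bound row column)
    where
    open Layout L
    InRow InColumn : Set
    InRow = ∃[ p ] IsP L p × p ≢ v × p Y.≬ v
    InColumn = ∃[ p ] IsP L p × p ≢ v × p X.≬ v
    bound : Dec InRow → Dec InColumn → AtMost 6 (IsQ L)
    bound (yes (p , Pp , p≢v , p≬v)) _ = crowded-row L Pv Pp p≢v p≬v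
    bound (no _) (yes (p , Pp , p≢v , p≬v)) = crowded-row (transpose L) Pv Pp p≢v p≬v
    bound (no row) (no column) = atMost-∪
      (AloneInRow.atMost-Row L Pv λ {p} Pp p≢v p≬v → row (p , Pp , p≢v , p≬v))
      (AloneInRow.atMost-Row (transpose L) Pv λ {p} Pp p≢v p≬v → column (p , Pp , p≢v , p≬v))
      λ Qq → Sum.map (λ s → Qq , H.Sees⇒≬ s) (λ s → Qq , Vt.Sees⇒≬ s)
               (adjacent⇒sees (P-adjacent-Q L Pv Qq))

-- Double negation commutes with finite conjunctions, so finitely many undecided comparisons may be
-- settled at once.
¬¬-All : ∀ {A : Set} {R : A → Set} xs → (∀ x → ¬ ¬ R x) → ¬ ¬ All R xs
¬¬-All [] _ k = k []
¬¬-All (x ∷ xs) ¬¬r k = ¬¬r x λ r → ¬¬-All xs ¬¬r λ rs → k (r ∷ rs)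

-- Squares with real coordinates

module Line {V : Set} (c : V → ℝ) where

  Endpoint : Set
  Endpoint = V × Bool

  position : Endpoint → ℝ
  position (v , false) = c v
  position (v , true) = c v +ᴿ 1ℚ

  Decided : Set
  Decided = ∀ e f → Dec (position e <ᴿ position f)

module _ {V : Set} (vertices : List V) (complete : ∀ v → v ∈ vertices) where

  endpoints : List (V × Bool)
  endpoints = cartesianProduct vertices (false ∷ true ∷ [])

  endpoints-complete : ∀ e → e ∈ endpoints
  endpoints-complete (v , false) = ∈-cartesianProduct⁺ (complete v) (here refl)
  endpoints-complete (v , true) = ∈-cartesianProduct⁺ (complete v) (there (here refl))

  ¬¬-decided : ∀ c → ¬ ¬ Line.Decided c
  ¬¬-decided c k = ¬¬-All endpoints
    (λ e → ¬¬-All endpoints (λ f → ¬¬-excluded-middle))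
    λ all → k λ e f → All.lookup (All.lookup all (endpoints-complete e)) (endpoints-complete f)

  module DecidedLine (c : V → ℝ) (_<?_ : Line.Decided c) where
    open Line c

    ≤ᴿ-total : ∀ e f → position e ≤ᴿ position f ⊎ position f ≤ᴿ position e
    ≤ᴿ-total e f with f <? e
    ... | yes f<e = inj₂ (<⇒≤ᴿ {position f} {position e} f<e)
    ... | no f≮e = inj₁ f≮e

    axis : Axis V
    axis = record
      { _≲_ = λ u v → c u ≤ᴿ c v
      ; _≺_ = λ u v → c u +ᴿ 1ℚ ≤ᴿ c v
      ; _≲?_ = λ u v → ¬? ((v , false) <? (u , false))
      ; _≺?_ = λ u v → ¬? ((v , false) <? (u , true))
      ; ≲-total = λ u v → ≤ᴿ-total (u , false) (v , false)
      ; ≲-trans = λ {u} {v} {w} → ≤ᴿ-trans {c u} {c v} {c w}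
      ; ≺-≲-trans = λ {u} {v} {w} → ≤ᴿ-trans {c u +ᴿ 1ℚ} {c v} {c w}
      ; ≲-≺-trans = λ {u} {v} {w} u≲v → ≤ᴿ-trans {c u +ᴿ 1ℚ} {c v +ᴿ 1ℚ} {c w}
          (u≲v ∘ +1-cancel-< {c v} {c u})
      ; ≺⇒⋦ = λ {u} {v} u≺v v≲u → ≤ᴿ-trans {c u +ᴿ 1ℚ} {c v} {c u} u≺v v≲u (x<x+1 (c u))
      }
    open Axis axis

    ⊀⇒< : ∀ {u v} → ¬ u ≺ v → c v <ᴿ c u +ᴿ 1ℚ
    ⊀⇒< {u} {v} = decidable-stable ((v , false) <? (u , true))

    ⋦⇒< : ∀ {u v} → ¬ u ≲ v → c v <ᴿ c u
    ⋦⇒< {u} {v} = decidable-stable ((v , false) <? (u , false))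

    Inside : V → ℝ → Set
    Inside v x = c v <ᴿ x × x <ᴿ c v +ᴿ 1ℚ

    inside : ∀ v → ∃ (Inside v)
    inside v = <ᴿ-dense {c v} {c v +ᴿ 1ℚ} (x<x+1 (c v))

    inside⇒≬ : ∀ {u v x} → Inside u x → Inside v x → u ≬ v
    inside⇒≬ {u} {v} {x} (u<x , x<u) (v<x , x<v) =
      (λ u≺v → u≺v (<ᴿ-trans {c v} {x} {c u +ᴿ 1ℚ} v<x x<u)) ,
      (λ v≺u → v≺u (<ᴿ-trans {c u} {x} {c v +ᴿ 1ℚ} u<x x<v))

    common-point : ∀ {u v} → u ≬ v → ∃[ x ] Inside u x × Inside v x
    common-point {u} {v} (u⊀v , v⊀u) with ≲-total u v
    ... | inj₁ u≲v = let x , v<x , x<u = <ᴿ-dense {c v} {c u +ᴿ 1ℚ} (⊀⇒< u⊀v) in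
      x , (≤-<-transᴿ {c u} {c v} {x} u≲v v<x , x<u) ,
      v<x , <-≤-transᴿ {x} {c u +ᴿ 1ℚ} {c v +ᴿ 1ℚ} x<u (u≲v ∘ +1-cancel-< {c v} {c u})
    ... | inj₂ v≲u = let x , u<x , x<v = <ᴿ-dense {c u} {c v +ᴿ 1ℚ} (⊀⇒< v⊀u) in
      x , (u<x , <-≤-transᴿ {x} {c v +ᴿ 1ℚ} {c u +ᴿ 1ℚ} x<v (v≲u ∘ +1-cancel-< {c u} {c v})) ,
      ≤-<-transᴿ {c v} {c u} {x} v≲u u<x , x<v

    next : ∀ {e f} → position e <ᴿ position f →
      ∃[ g ] position e <ᴿ position g × (∀ h → position e <ᴿ position h → position g ≤ᴿ position h)
    next {e} {f} e<f
      with minimal {_≤_ = λ g h → position g ≤ᴿ position h} ≤ᴿ-total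
             (λ {g} {h} {i} → ≤ᴿ-trans {position g} {position h} {position i}) (e <?_) endpoints
    ... | inj₁ none = contradiction e<f (All.lookup none (endpoints-complete f))
    ... | inj₂ (g , e<g , least) = g , e<g , λ h → All.lookup least (endpoints-complete h)

    previous : ∀ {e f} → position f <ᴿ position e →
      ∃[ g ] position g <ᴿ position e × (∀ h → position h <ᴿ position e → position h ≤ᴿ position g)
    previous {e} {f} f<e
      with minimal {_≤_ = λ g h → position h ≤ᴿ position g} (flip ≤ᴿ-total)
             (λ {g} {h} {i} g≥h h≥i → ≤ᴿ-trans {position i} {position h} {position g} h≥i g≥h)
             (_<? e) endpoints
    ... | inj₁ none = contradiction f<e (All.lookup none (endpoints-complete f))
    ... | inj₂ (g , g<e , greatest) = g , g<e , λ h → All.lookup greatest (endpoints-complete h)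

    -- Realises the formal cell `d` as an open interval of reals free of ends of sides, so that each
    -- square covers all of it or none.
    record Gap (d : Cell V) : Set₁ where
      field
        lower upper : ℝ
        lower<upper : lower <ᴿ upper
        ∋⇒inside : ∀ {u x} → d ∋ u → lower <ᴿ x → x <ᴿ upper → Inside u x
        inside⇒∋ : ∀ {u x} → lower <ᴿ x → x <ᴿ upper → Inside u x → d ∋ u

    gap : ∀ d → Gap d
    -- The interval runs from the lower end of `v` to the next end of any side; the upper end of `v`
    -- guarantees that there is one.
    gap (low v) = let g , v<g , least = next {v , false} {v , true} (x<x+1 (c v)) in record
      { lower = c v ; upper = position g ; lower<upper = v<g
      ; ∋⇒inside = λ {u} {x} (u≲v , u⊀v) v<x x<g →
          ≤-<-transᴿ {c u} {c v} {x} u≲v v<x ,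
          <-≤-transᴿ {x} {position g} {c u +ᴿ 1ℚ} x<g (least (u , true) (⊀⇒< u⊀v))
      ; inside⇒∋ = λ {u} {x} v<x x<g (u<x , x<u) →
          (λ v<u → least (u , false) v<u (<ᴿ-trans {c u} {x} {position g} u<x x<g)) ,
          (λ u≺v → u≺v (<ᴿ-trans {c v} {x} {c u +ᴿ 1ℚ} v<x x<u)) }
    gap (high v) = let g , g<v , greatest = previous {v , true} {v , false} (x<x+1 (c v)) in record
      { lower = position g ; upper = c v +ᴿ 1ℚ ; lower<upper = g<v
      ; ∋⇒inside = λ {u} {x} (v≲u , v⊀u) g<x x<v →
          ≤-<-transᴿ {c u} {position g} {x} (greatest (u , false) (⊀⇒< v⊀u)) g<x ,
          <-≤-transᴿ {x} {c v +ᴿ 1ℚ} {c u +ᴿ 1ℚ} x<v (v≲u ∘ +1-cancel-< {c u} {c v})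
      ; inside⇒∋ = λ {u} {x} g<x x<v (u<x , x<u) →
          (λ u<v → greatest (u , true) (+1-mono-< {c u} {c v} u<v)
            (<ᴿ-trans {position g} {x} {c u +ᴿ 1ℚ} g<x x<u)) ,
          (λ v≺u → v≺u (<ᴿ-trans {c u} {x} {c v +ᴿ 1ℚ} u<x x<v)) }

  -- Bands of visibility between real squares

  module _ (corner : V → Point) (disjoint : InteriorsDisjoint corner)
           (_<ˣ?_ : Line.Decided (proj₁ ∘ corner)) (_<ʸ?_ : Line.Decided (proj₂ ∘ corner)) where
    private
      module LX = DecidedLine (proj₁ ∘ corner) _<ˣ?_
      module LY = DecidedLine (proj₂ ∘ corner) _<ʸ?_
      module X = Axis LX.axis
      module Y = Axis LY.axis
      a b : V → ℝ
      a = proj₁ ∘ corner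
      b = proj₂ ∘ corner

    no-overlap : ∀ {v w} → v ≢ w → v X.≬ w → ¬ v Y.≬ w
    no-overlap {v} {w} v≢w xs ys =
      let x , xv , xw = LX.common-point xs
          y , yv , yw = LY.common-point ys
      in disjoint v w v≢w ((x , y) , (xv , yv) , (xw , yw))

    scan : Scan LX.axis LY.axis
    scan = record
      { Sees = HorizontalBand corner
      ; Sees-sym = λ (s , t , s<t , band) → s , t , s<t , λ y s<y y<t →
          let v , w , free = band y s<y y<t
          in w , v , λ x between u u≢w u≢v → free x (Sum.swap between) u u≢v u≢w
      ; Sees⇒≬ = λ {v} {w} (s , t , s<t , band) →
          let y , s<y , y<t = <ᴿ-dense {s} {t} s<t
              (_ , _ , yv) , (_ , _ , yw) , _ = band y s<y y<t
          in LY.inside⇒≬ {v} {w} {y} yv yw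
      ; obstacles = λ {v} {w} {u} {u′} → obstacles {v} {w} {u} {u′}
      ; consecutive = λ d {v} {w} → consecutive d {v} {w}
      }
      where
      obstacles : ∀ {v w u u′} → HorizontalBand corner v w →
        v X.≺ u → u X.≺ w → v X.≺ u′ → u′ X.≺ w → u Y.≬ u′ →
        (Y.Above v w u × Y.Above v w u′) ⊎ (Y.Below v w u × Y.Below v w u′)
      obstacles {v} {w} {u} {u′} (s , t , s<t , band) v≺u u≺w v≺u′ u′≺w u≬u′ =
        conclude (side v≺u u≺w) (side v≺u′ u′≺w)
        where
        y : ℝ
        y = proj₁ (<ᴿ-dense {s} {t} s<t)
        s<y : s <ᴿ y
        s<y = proj₁ (proj₂ (<ᴿ-dense {s} {t} s<t))
        y<t : y <ᴿ t
        y<t = proj₂ (proj₂ (<ᴿ-dense {s} {t} s<t))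
        yv : LY.Inside v y
        yv = proj₂ (proj₂ (proj₁ (band y s<y y<t)))
        yw : LY.Inside w y
        yw = proj₂ (proj₂ (proj₁ (proj₂ (band y s<y y<t))))

        missed : ∀ {u} → v X.≺ u → u X.≺ w → ¬ LY.Inside u y
        missed {u} v≺u u≺w yu =
          let x , xu@(u<x , x<u) = LX.inside u
          in proj₂ (proj₂ (band y s<y y<t)) x
               (inj₁ ( <⇒≤ᴿ {a v +ᴿ 1ℚ} {x} (≤-<-transᴿ {a v +ᴿ 1ℚ} {a u} {x} v≺u u<x)
                     , <⇒≤ᴿ {x} {a w} (<-≤-transᴿ {x} {a u +ᴿ 1ℚ} {a w} x<u u≺w)))
               u (≢-sym (X.≺⇒≢ v≺u)) (X.≺⇒≢ u≺w) (xu , yu)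

        Over Under : V → Set
        Over u = y ≤ᴿ b u
        Under u = b u +ᴿ 1ℚ ≤ᴿ y

        -- The obstacle misses the line at height `y`. If not higher than `v`, it starts below `y`
        -- and must end by then; otherwise it ends above `y` and must start no earlier.
        side : ∀ {u} → v X.≺ u → u X.≺ w → Over u ⊎ Under u
        side {u} v≺u u≺w with u Y.≲? v
        ... | yes u≲v = inj₂ λ y<u →
                missed v≺u u≺w (≤-<-transᴿ {b u} {b v} {y} u≲v (proj₁ yv) , y<u)
        ... | no u⋦v = inj₁ λ u<y → missed v≺u u≺w (u<y ,
                <ᴿ-trans {y} {b v +ᴿ 1ℚ} {b u +ᴿ 1ℚ} (proj₂ yv) (+1-mono-< {b v} {b u} (LY.⋦⇒< u⋦v)))

        over⇒⋦ : ∀ {u z} → LY.Inside z y → Over u → ¬ u Y.≲ z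
        over⇒⋦ {u} {z} (z<y , _) y≤u = λ u≲z → ≤ᴿ-trans {y} {b u} {b z} y≤u u≲z z<y

        under⇒⋦ : ∀ {u z} → LY.Inside z y → Under u → ¬ z Y.≲ u
        under⇒⋦ {u} {z} (_ , y<z) u≤y = λ z≲u →
          u≤y (<-≤-transᴿ {y} {b z +ᴿ 1ℚ} {b u +ᴿ 1ℚ} y<z (z≲u ∘ +1-cancel-< {b u} {b z}))

        above : ∀ {u} → Over u → Y.Above v w u
        above o = over⇒⋦ yv o , over⇒⋦ yw o

        below : ∀ {u} → Under u → Y.Below v w u
        below o = under⇒⋦ yv o , under⇒⋦ yw o

        conclude : Over u ⊎ Under u → Over u′ ⊎ Under u′ →
          (Y.Above v w u × Y.Above v w u′) ⊎ (Y.Below v w u × Y.Below v w u′)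
        conclude (inj₁ o) (inj₁ o′) = inj₁ (above o , above o′)
        conclude (inj₂ o) (inj₂ o′) = inj₂ (below o , below o′)
        conclude (inj₁ o) (inj₂ o′) =
          contradiction (≤ᴿ-trans {b u′ +ᴿ 1ℚ} {y} {b u} o′ o) (proj₂ u≬u′)
        conclude (inj₂ o) (inj₁ o′) =
          contradiction (≤ᴿ-trans {b u +ᴿ 1ℚ} {y} {b u′} o o′) (proj₁ u≬u′)

      consecutive : ∀ d {v w} → d Y.∋ v → d Y.∋ w → v X.≺ w →
        -- The band is the interval realising `d`: a square obstructing it would cover `d` and lie
        -- strictly between `v` and `w`.
        (∀ u → d Y.∋ u → v X.≺ u → ¬ u X.≺ w) → HorizontalBand corner v w
      consecutive d {v} {w} ∋v ∋w v≺w none = lower , upper , lower<upper , λ y s<y y<t →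
        (proj₁ (LX.inside v) , proj₂ (LX.inside v) , ∋⇒inside {v} {y} ∋v s<y y<t) ,
        (proj₁ (LX.inside w) , proj₂ (LX.inside w) , ∋⇒inside {w} {y} ∋w s<y y<t) ,
        λ { x (inj₁ (v<x , x<w)) u u≢v u≢w (xu , yu) →
              let ∋u = inside⇒∋ {u} {y} s<y y<t yu
              in none u ∋u (right-of x u u≢v v<x xu (Y.∋⇒≬ d {u} {v} ∋u ∋v))
                           (left-of x u u≢w x<w xu (Y.∋⇒≬ d {u} {w} ∋u ∋w))
          ; x (inj₂ (w<x , x<v)) _ _ _ _ →
              X.≺⇒⋦ {v} {w} v≺w (X.≺⇒≲ {w} {v} (≤ᴿ-trans {a w +ᴿ 1ℚ} {x} {a v} w<x x<v)) }
        where
        open LY.Gap (LY.gap d)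
        right-of : ∀ x u {v} → u ≢ v → a v +ᴿ 1ℚ ≤ᴿ x → LX.Inside u x → u Y.≬ v → v X.≺ u
        right-of x u {v} u≢v v≤x (u<x , x<u) y = decidable-stable (v X.≺? u) λ v⊀u →
          no-overlap u≢v
            ((λ u≺v → <ᴿ-irrefl {x} (<-≤-transᴿ {x} {a u +ᴿ 1ℚ} {x} x<u
               (≤ᴿ-trans {a u +ᴿ 1ℚ} {a v +ᴿ 1ℚ} {x}
                 (<⇒≤ᴿ {a u +ᴿ 1ℚ} {a v +ᴿ 1ℚ} (≤-<-transᴿ {a u +ᴿ 1ℚ} {a v} {a v +ᴿ 1ℚ} u≺v (x<x+1 (a v))))
                 v≤x)))
            , v⊀u) y
        left-of : ∀ x u {w} → u ≢ w → x ≤ᴿ a w → LX.Inside u x → u Y.≬ w → u X.≺ w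
        left-of x u {w} u≢w x≤w (u<x , x<u) y = decidable-stable (u X.≺? w) λ u⊀w →
          no-overlap u≢w
            (u⊀w , λ w≺u → X.≺⇒⋦ w≺u
              (<⇒≤ᴿ {a u} {a w} (<-≤-transᴿ {a u} {x} {a w} u<x x≤w))) y

-- Representations of complete bipartite graphs as layouts

module _ (m n : ℕ) where

  private
    V : Set
    V = Fin m ⊎ Fin n

  vertices : List V
  vertices = map inj₁ (allFin m) ++ map inj₂ (allFin n)

  complete : ∀ v → v ∈ vertices
  complete (inj₁ i) = ∈-++⁺ˡ (∈-map⁺ inj₁ (∈-allFin i))
  complete (inj₂ j) = ∈-++⁺ʳ (map inj₁ (allFin m)) (∈-map⁺ inj₂ (∈-allFin j))

  side : V → Bool
  side = [ const false , const true ]′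

  adj⇒side : ∀ v w → FiniteSimpleGraph.Adj (K m n) v w → side v ≡ not (side w)
  adj⇒side (inj₁ _) (inj₂ _) _ = refl
  adj⇒side (inj₂ _) (inj₁ _) _ = refl

  side⇒adj : ∀ v w → side v ≡ not (side w) → FiniteSimpleGraph.Adj (K m n) v w
  side⇒adj (inj₁ _) (inj₂ _) _ = tt
  side⇒adj (inj₂ _) (inj₁ _) _ = tt

  layout : (urvg : IsURVG (K m n)) → Line.Decided (proj₁ ∘ proj₁ urvg) →
           Line.Decided (proj₂ ∘ proj₁ urvg) → Layout V
  layout (corner , disjoint , visible) _<ˣ?_ _<ʸ?_ = record
    { X = DecidedLine.axis vertices complete (proj₁ ∘ corner) _<ˣ?_
    ; Y = DecidedLine.axis vertices complete (proj₂ ∘ corner) _<ʸ?_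
    ; horizontal = scan vertices complete corner disjoint _<ˣ?_ _<ʸ?_
    -- Vertical bands are by definition horizontal bands for the swapped corners.
    ; vertical = scan vertices complete (swap ∘ corner)
        (λ v w v≢w ((x , y) , (xv , yv) , (xw , yw)) →
          disjoint v w v≢w ((y , x) , (yv , xv) , (yw , xw))) _<ʸ?_ _<ˣ?_
    ; vertices = vertices
    ; complete = complete
    ; side = side
    ; interiors-disjoint = no-overlap vertices complete corner disjoint _<ˣ?_ _<ʸ?_
    ; adjacent⇒sees = λ {v} {w} opposite → Equivalence.to
        (visible v w λ { refl → not-¬ refl opposite }) (side⇒adj v w opposite)
    ; sees⇒adjacent = λ {v} {w} v≢w → adj⇒side v w ∘ Equivalence.from (visible v w v≢w)
    }

lemma5p4 : ∀ (m n : ℕ) → 1 ≤ m → m ≤ n → 7 ≤ n → ¬ IsURVG (K m n)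
lemma5p4 m@(suc _) n _ _ 7≤n urvg =
  ¬¬-decided (vertices m n) (complete m n) (proj₁ ∘ proj₁ urvg) λ decˣ →
  ¬¬-decided (vertices m n) (complete m n) (proj₂ ∘ proj₁ urvg) λ decʸ →
  -- The first vertex of the smaller side serves as `v`; listing the whole other side then gives `n`
  -- ≤ 6.
  too-many-Q (layout m n urvg decˣ decʸ) {inj₁ zero} refl λ atMost-6 →
  ℕ.<⇒≱ 7≤n (subst (ℕ._≤ 6) (trans (length-map inj₂ (allFin n)) (length-tabulate id))
    (atMost-6 (Unique.map⁺ inj₂-injective (Unique.allFin⁺ n))
              (All.map⁺ (All.universal (λ _ → refl) (allFin n)))))
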